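{- Let $k\ge 1$ and $n\ge 2k$. Then \[ l_k(n)=\binom{n-1}{\lceil k/2\rceil-1}+\binom{n-1}{\lfloor k/2\rfloor-1}. \] Equivalently, for $k\ge1$: $l_{2k}(n)=2\binom{n-1}{k-1}$ whenever $n\ge 4k$, and $l_{2k+1}(n)=\binom{n}{k}$ whenever $n\ge 4k+2$. In particular, for $n\ge 2k$, $l_k(n)$ is a polynomial in $n$ of degree $\lceil (k-2)/2\rceil$.
   Context: For a positive integer $m$, $P_m$ denotes the path with vertex set $[m]=\{1,\dots,m\}$ in which $i$ and $j$ are adjacent iff $|i-j|=1$. An endomorphism of $P_n$ is a map $f:[n]\to[n]$ with $|f(i)-f(i+1)|=1$ for all $1\le i\le n-1$. Every endomorphism $f$ induces a partition of $[n]$ whose blocks are the nonempty fibers $f^{ -1}(y)$. Let $\mathscr C(P_n)$ be the set of partitions of $[n]$ induced by endomorphisms of $P_n$, and for $1\le k\le n-1$ let $l_k(n)=|\{\rho\in\mathscr C(P_n): \rho \text{ has exactly } n-k+1 \text{ blocks}\}|$. Convention: $\binom{a}{b}=0$ if $b<0$ or $b>a$. -}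

module Defs where

open import Data.Bool.Properties using () renaming (_≟_ to _≟ᵇ_)
open import Data.Fin.Base using (Fin; toℕ)
import Data.Fin.Properties as Fin
open import Data.Fin.Subset using (Subset)
open import Data.Fin.Subset.Properties using (nonempty?)
open import Data.Integer.Base using (ℤ; +_; -[1+_])
open import Data.List.Base
  using (List; []; _∷_; map; filter; length; allFin; deduplicate; cartesianProductWith)
import Data.List.Relation.Binary.Subset.DecPropositional as DecSubset
open import Data.List.Relation.Binary.Subset.Propositional using (_⊆_)
open import Data.Nat.Base using (ℕ; zero; suc; _+_; _∸_; _≤_; ∣_-_∣; ⌈_/2⌉)
open import Data.Nat.Combinatorics using (_C_)
import Data.Nat.Properties as ℕ
open import Data.Product.Base using (Σ-syntax; _×_)
open import Data.Rational.Base as ℚ using (ℚ; 0ℚ)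
open import Data.Vec.Base as Vec using (Vec; lookup)
import Data.Vec.Properties as Vec
open import Relation.Binary.Definitions using (Decidable)
open import Relation.Binary.PropositionalEquality.Core using (_≡_; _≢_)
open import Relation.Nullary.Decidable using (does; _→-dec_; _×-dec_)
import Relation.Unary as U

-- The vertex set [n] is Fin n (vertex i of the path is the element i - 1).
-- A self-map of [n] is given by its vector of values, so that there is
-- exactly one vector per map.

SelfMap : ℕ → Set
SelfMap n = Vec (Fin n) n

Adjacent : ∀ {n} → Fin n → Fin n → Set
Adjacent i j = ∣ toℕ i - toℕ j ∣ ≡ 1

IsEndomorphism : ∀ {n} → SelfMap n → Set
IsEndomorphism f =
  ∀ i j → toℕ j ≡ suc (toℕ i) → Adjacent (lookup f i) (lookup f j)

isEndomorphism? : ∀ {n} → U.Decidable (IsEndomorphism {n})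
isEndomorphism? f = Fin.all? λ i → Fin.all? λ j →
  (toℕ j ℕ.≟ suc (toℕ i)) →-dec
  (∣ toℕ (lookup f i) - toℕ (lookup f j) ∣ ℕ.≟ 1)

words : ∀ {A : Set} → List A → (m : ℕ) → List (Vec A m)
words xs zero    = Vec.[] ∷ []
words xs (suc m) = cartesianProductWith Vec._∷_ xs (words xs m)

endomorphisms : (n : ℕ) → List (SelfMap n)
endomorphisms n = filter isEndomorphism? (words (allFin n) n)

-- A partition is listed by its blocks; the order of the list is irrelevant,
-- so two lists are identified when they have the same blocks.

Blocks : ℕ → Set
Blocks n = List (Subset n)

_≈_ : ∀ {n} → Blocks n → Blocks n → Set
ρ ≈ σ = (ρ ⊆ σ) × (σ ⊆ ρ)

_≈?_ : ∀ {n} → Decidable (_≈_ {n})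
ρ ≈? σ = (ρ ⊆? σ) ×-dec (σ ⊆? ρ)
  where open DecSubset (Vec.≡-dec _≟ᵇ_) using (_⊆?_)

fibre : ∀ {n} → SelfMap n → Fin n → Subset n
fibre f y = Vec.map (λ z → does (z Fin.≟ y)) f

-- Distinct nonempty fibres are different subsets, so the length of this list
-- is the number of blocks.

induced : ∀ {n} → SelfMap n → Blocks n
induced {n} f = filter nonempty? (map (fibre f) (allFin n))

𝒞 : (n : ℕ) → List (Blocks n)
𝒞 n = deduplicate _≈?_ (map induced (endomorphisms n))

-- Meaningful for 1 ≤ k ≤ n - 1.

l : ℕ → ℕ → ℕ
l k n = length (filter (λ ρ → length ρ ℕ.≟ (n ∸ k) + 1) (𝒞 n))

-- a C b is already 0 when b > a.

binom : ℕ → ℤ → ℕ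
binom a (+ b)    = a C b
binom a -[1+ _ ] = 0

-- Coefficients are listed from the constant term upwards.

evaluate : ∀ {m} → Vec ℚ m → ℚ → ℚ
evaluate Vec.[]      x = 0ℚ
evaluate (c Vec.∷ cs) x = c ℚ.+ x ℚ.* evaluate cs x

fromℕ : ℕ → ℚ
fromℕ n = (+ n) ℚ./ 1

PolynomialFrom : (n₀ d : ℕ) → (ℕ → ℕ) → Set
PolynomialFrom n₀ d g =
  Σ[ c ∈ Vec ℚ (suc d) ]
    (Vec.last c ≢ 0ℚ) ×
    (∀ n → n₀ ≤ n → fromℕ (g n) ≡ evaluate c (fromℕ n))

-- ⌈(k - 2)/2⌉ for k ≥ 1; at k = 1 the truncated subtraction is harmless since
-- ⌈-1/2⌉ = 0.

degree : ℕ → ℕ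
degree k = ⌈ k ∸ 2 /2⌉

{-# OPTIONS --safe #-}
module Submission where

-- Reading off the steps of an endomorphism gives a ±1 word of length n - 1, and
-- two endomorphisms induce the same partition iff their words agree up to a
-- global sign, since b ≢ c for consecutive steps b, c iff the walk returns to a
-- vertex after them. With r = n - k, the number of blocks is r + 1 iff the walk
-- spans r + 1 heights, that is, iff r is the larger of the greatest rise and the
-- greatest fall of the word. Rise and fall together use at most n - 1 < 2 r
-- steps, so exactly one of the two words of a partition has greatest rise r.
-- The rise above the running minimum is a reflected walk, and the reflection
-- principle turns the number of words whose greatest rise is at least r into
-- H(r) + H(r + 1), with H(a) the number of words climbing a above the start.
-- Hence l k n = H(r) - H(r + 2), a sum of two binomial coefficients.

open import Defs
open import Data.Bool.Base using (Bool; true; false; not)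
open import Data.Bool.Properties using (not-involutive; not-injective)
open import Data.Fin.Base using (Fin; zero; suc; toℕ; fromℕ<)
import Data.Fin.Properties as Fin
open import Data.Fin.Subset using (_∈_)
open import Data.Fin.Subset.Properties using (nonempty?; ⊆-antisym)
open import Data.Integer.Base as ℤ using (+_; 1ℤ) renaming (_-_ to _-ℤ_)
import Data.Integer.Properties as ℤ
open import Data.List.Base using (List; []; _∷_; _++_; length; map; filter; allFin; upTo)
import Data.List.Membership.Propositional as List
open import Data.List.Membership.Propositional.Properties
import Data.List.Properties as List
import Data.List.Relation.Binary.Subset.Propositional as List⊆
open import Data.List.Relation.Unary.All as All using (All; []; _∷_)
import Data.List.Relation.Unary.All.Properties as All
open import Data.List.Relation.Unary.AllPairs as AllPairs using (AllPairs; []; _∷_)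
import Data.List.Relation.Unary.AllPairs.Properties as AllPairs
open import Data.List.Relation.Unary.Any as Any using (Any; here; there; _─_)
import Data.List.Relation.Unary.Any.Properties as Any
import Data.List.Relation.Unary.Unique.DecSetoid.Properties as UniqueDec
open import Data.List.Relation.Unary.Unique.Propositional using (Unique)
import Data.List.Relation.Unary.Unique.Propositional.Properties as Unique
open import Data.Nat.Base
open import Data.Nat.Combinatorics using (_C_; nCn≡1; nC1≡n; nCk≡nC[n∸k]; nCk+nC[k+1]≡[n+1]C[k+1])
open import Data.Nat.Properties
open import Data.Nat.Tactic.RingSolver using (solve-∀)
open import Data.Product.Base using (_×_; _,_; ∃; ∃₂)
open import Data.Rational.Base as ℚ using (ℚ; 0ℚ; 1ℚ)
import Data.Rational.Properties as ℚ
open import Data.Rational.Solver using (module +-*-Solver)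
import Data.Rational.Unnormalised.Base as ℚᵘ
import Data.Rational.Unnormalised.Properties as ℚᵘ
open import Data.Sum.Base as Sum using (_⊎_; inj₁; inj₂; swap)
open import Data.Vec.Base as Vec using (Vec; []; _∷_; lookup)
import Data.Vec.Properties as Vec
open import Function.Base using (_∘_; id)
open import Function.Bundles using (_⇔_; mk⇔; Equivalence)
open import Function.Properties.Equivalence using () renaming (sym to ⇔-sym; trans to ⇔-trans)
open import Level using (0ℓ)
open import Relation.Binary.Bundles using (DecSetoid)
open import Relation.Binary.PropositionalEquality
open import Relation.Nullary using (yes; no; ¬_; contradiction; does)
open import Relation.Unary as U using (Pred)

-- Counting ±1 words

signs : List Bool
signs = true ∷ false ∷ []

count : ∀ {m} {P : Pred (Vec Bool m) 0ℓ} → U.Decidable P → ℕ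
count {m} P? = length (filter P? (words signs m))

length-filter-map : ∀ {A B : Set} {P : Pred B 0ℓ} (P? : U.Decidable P) (f : A → B) xs →
  length (filter P? (map f xs)) ≡ length (filter (P? ∘ f) xs)
length-filter-map P? f []       = refl
length-filter-map P? f (x ∷ xs) with P? (f x)
... | yes _ = cong suc (length-filter-map P? f xs)
... | no  _ = length-filter-map P? f xs

count-suc : ∀ {m} {P : Pred (Vec Bool (suc m)) 0ℓ} (P? : U.Decidable P) →
  count P? ≡ count (P? ∘ (true ∷_)) + count (P? ∘ (false ∷_))
count-suc {m} P? = begin
  length (filter P? (map (true ∷_) ws ++ map (false ∷_) ws ++ []))
    ≡⟨ cong (λ vs → length (filter P? (map (true ∷_) ws ++ vs))) (List.++-identityʳ _) ⟩
  length (filter P? (map (true ∷_) ws ++ map (false ∷_) ws))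
    ≡⟨ cong length (List.filter-++ P? (map (true ∷_) ws) _) ⟩
  length (filter P? (map (true ∷_) ws) ++ filter P? (map (false ∷_) ws))
    ≡⟨ List.length-++ (filter P? (map (true ∷_) ws)) ⟩
  length (filter P? (map (true ∷_) ws)) + length (filter P? (map (false ∷_) ws))
    ≡⟨ cong₂ _+_ (length-filter-map P? _ ws) (length-filter-map P? _ ws) ⟩
  count (P? ∘ (true ∷_)) + count (P? ∘ (false ∷_)) ∎
  where
  open ≡-Reasoning
  ws = words signs m

count-≐ : ∀ {m} {P Q : Pred (Vec Bool m) 0ℓ} (P? : U.Decidable P) (Q? : U.Decidable Q) →
  P U.≐ Q → count P? ≡ count Q?
count-≐ {m} P? Q? P≐Q = cong length (List.filter-≐ P? Q? P≐Q (words signs m))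

count-always : ∀ {m} {P : Pred (Vec Bool m) 0ℓ} (P? : U.Decidable P) →
  (∀ v → P v) → count P? ≡ 2 ^ m
count-always {zero}  P? all with P? []
... | yes _  = refl
... | no ¬p  = contradiction (all []) ¬p
count-always {suc m} P? all = begin
  count P? ≡⟨ count-suc P? ⟩
  count (P? ∘ (true ∷_)) + count (P? ∘ (false ∷_))
    ≡⟨ cong₂ _+_ (count-always _ (all ∘ (true ∷_))) (count-always _ (all ∘ (false ∷_))) ⟩
  2 ^ m + 2 ^ m ≡⟨ cong (_+_ (2 ^ m)) (sym (+-identityʳ _)) ⟩
  2 ^ suc m ∎
  where open ≡-Reasoning

-- The maximum of the walk with steps v (true is up) that starts at x and stays
-- put instead of stepping below 0; from 0 this is the greatest rise of v.
peak : ∀ {m} → ℕ → Vec Bool m → ℕ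
peak x []          = x
peak x (true  ∷ v) = peak (suc x) v
peak x (false ∷ v) = x ⊔ peak (pred x) v

x≤peak : ∀ {m} x (v : Vec Bool m) → x ≤ peak x v
x≤peak x []          = ≤-refl
x≤peak x (true  ∷ v) = ≤-trans (n≤1+n x) (x≤peak (suc x) v)
x≤peak x (false ∷ v) = m≤m⊔n x _

-- The number of ±1 walks of length m that climb a steps above their start.
hits : ℕ → ℕ → ℕ
hits m       zero    = 2 ^ m
hits zero    (suc a) = 0
hits (suc m) (suc a) = hits m a + hits m (suc (suc a))

hits-zero : ∀ {m a} → m < a → hits m a ≡ 0
hits-zero {zero}  {suc a} _         = refl
hits-zero {suc m} {suc a} (s≤s m<a) =
  cong₂ _+_ (hits-zero m<a) (hits-zero (≤-trans m<a (≤-trans (n≤1+n a) (n≤1+n (suc a)))))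

-- The reflected walk behaves like |S + ½| - ½ for a free walk S, so it climbs
-- to a + x when S hits a + x or its mirror image; m is too small for both.
count-peak≥ : ∀ m a x → m ≤ 2 * (a + x) →
  count {m} (λ v → a + x ≤? peak x v) ≡ hits m a + hits m (suc (a + 2 * x))
count-peak≥ m zero x m≤ = begin
  count {m} (λ v → x ≤? peak x v) ≡⟨ count-always {m} (λ v → x ≤? peak x v) (x≤peak x) ⟩
  2 ^ m                           ≡⟨ sym (+-identityʳ _) ⟩
  -- The bound on m enters here: the mirror image of the level lies 2 x + 1 above the start, out of
  -- reach for m steps.
  2 ^ m + 0                       ≡⟨ cong (_+_ (2 ^ m)) (sym (hits-zero (s≤s m≤))) ⟩
  2 ^ m + hits m (suc (2 * x)) ∎
  where open ≡-Reasoning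
count-peak≥ zero (suc a) x m≤ =
  cong length (List.filter-reject (λ v → suc a + x ≤? peak x v) {x = []} {xs = []}
    (λ le → 1+n≰n (≤-trans (s≤s (m≤n+m x a)) le)))
count-peak≥ (suc m) (suc a) zero m≤ = begin
  count {suc m} (λ v → suc a + 0 ≤? peak 0 v)
    ≡⟨ count-suc {m} (λ v → suc a + 0 ≤? peak 0 v) ⟩
  count {m} (λ v → suc a + 0 ≤? peak 1 v) + count {m} (λ v → suc a + 0 ≤? peak 0 v)
    -- The down step at 0 is absorbed, so the second branch starts again from 0. Both branches keep
    -- the target level, hence also the bound on m.
    ≡⟨ cong₂ _+_ (trans (cong (λ t → count {m} (λ v → t ≤? peak 1 v)) (sym (+-suc a 0)))
                        (count-peak≥ m a 1 (≤-trans (n≤1+n m) (subst (λ t → suc m ≤ 2 * t) (sym (+-suc a 0)) m≤))))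
                 (count-peak≥ m (suc a) 0 (≤-trans (n≤1+n m) m≤)) ⟩
  (hits m a + hits m (suc (a + 2))) + (hits m (suc a) + hits m (suc (suc (a + 0))))
    ≡⟨ cong₂ (λ s t → (hits m a + hits m (suc s)) + (hits m (suc a) + hits m (suc (suc t))))
             (+-comm a 2) (+-identityʳ a) ⟩
  (hits m a + hits m (3 + a)) + (hits m (suc a) + hits m (2 + a))
    ≡⟨ solve (hits m a) (hits m (3 + a)) (hits m (suc a)) (hits m (2 + a)) ⟩
  (hits m a + hits m (2 + a)) + (hits m (suc a) + hits m (3 + a))
    ≡⟨ cong (λ t → (hits m a + hits m (2 + a)) + (hits m (suc t) + hits m (3 + t))) (sym (+-identityʳ a)) ⟩
  hits (suc m) (suc a) + hits (suc m) (suc (suc a + 0)) ∎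
  where
  open ≡-Reasoning
  solve : ∀ p q r s → (p + q) + (r + s) ≡ (p + s) + (r + q)
  solve = solve-∀
count-peak≥ (suc m) (suc a) (suc x) m≤ = begin
  count {suc m} (λ v → suc a + suc x ≤? peak (suc x) v)
    ≡⟨ count-suc {m} (λ v → suc a + suc x ≤? peak (suc x) v) ⟩
  count {m} (λ v → suc a + suc x ≤? peak (2 + x) v)
    + count {m} (λ v → suc a + suc x ≤? suc x ⊔ peak x v)
    ≡⟨ cong₂ _+_ (trans (cong (λ t → count {m} (λ v → t ≤? peak (2 + x) v)) (sym (+-suc a (suc x))))
                        (count-peak≥ m a (2 + x) (≤-trans (n≤1+n m) (subst (λ t → suc m ≤ 2 * t) (sym (+-suc a (suc x))) m≤))))
                 (trans (count-≐ {m} (λ v → suc a + suc x ≤? suc x ⊔ peak x v) (λ v → 2 + a + x ≤? peak x v)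
                                ((λ {v} → below v) , (λ {v} → above v)))
                        (count-peak≥ m (2 + a) x (≤-trans (n≤1+n m) (subst (λ t → suc m ≤ 2 * t) (+-suc (suc a) x) m≤)))) ⟩
  (hits m a + hits m (suc (a + 2 * (2 + x)))) + (hits m (2 + a) + hits m (suc (2 + a + 2 * x)))
    ≡⟨ cong₂ (λ s t → (hits m a + hits m s) + (hits m (2 + a) + hits m t)) (e₁ a x) (e₂ a x) ⟩
  (hits m a + hits m (2 + (suc a + 2 * suc x))) + (hits m (2 + a) + hits m (suc a + 2 * suc x))
    ≡⟨ solve (hits m a) _ (hits m (2 + a)) _ ⟩
  (hits m a + hits m (2 + a)) + (hits m (suc a + 2 * suc x) + hits m (2 + (suc a + 2 * suc x))) ∎
  where
  open ≡-Reasoning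
  solve : ∀ p q r s → (p + q) + (r + s) ≡ (p + r) + (s + q)
  solve = solve-∀
  e₁ : ∀ a x → suc (a + 2 * (2 + x)) ≡ 2 + (suc a + 2 * suc x)
  e₁ = solve-∀
  e₂ : ∀ a x → suc (2 + a + 2 * x) ≡ suc a + 2 * suc x
  e₂ = solve-∀
  below : ∀ (v : Vec Bool m) → suc a + suc x ≤ suc x ⊔ peak x v → 2 + a + x ≤ peak x v
  below v le with ⊔-sel (suc x) (peak x v)
  ... | inj₁ e = contradiction (≤-trans (s≤s (m≤n+m (suc x) a)) (subst (suc a + suc x ≤_) e le)) 1+n≰n
  ... | inj₂ e = subst₂ _≤_ (+-suc (suc a) x) e le
  above : ∀ (v : Vec Bool m) → 2 + a + x ≤ peak x v → suc a + suc x ≤ suc x ⊔ peak x v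
  above v le = subst (_≤ suc x ⊔ peak x v) (sym (+-suc (suc a) x)) (≤-trans le (m≤n⊔m (suc x) (peak x v)))

-- Walk counts as binomial coefficients

nC0≡1 : ∀ n → n C 0 ≡ 1
nC0≡1 n = trans (nCk≡nC[n∸k] {0} {n} z≤n) (nCn≡1 n)

mid-symmetric : ∀ n → n C ⌊ n /2⌋ ≡ n C ⌈ n /2⌉
mid-symmetric n = trans (nCk≡nC[n∸k] (⌊n/2⌋≤n n)) (cong (n C_) rest)
  where
  rest : n ∸ ⌊ n /2⌋ ≡ ⌈ n /2⌉
  rest = trans (cong (_∸ ⌊ n /2⌋) (sym (⌊n/2⌋+⌈n/2⌉≡n n))) (m+n∸m≡n ⌊ n /2⌋ ⌈ n /2⌉)

-- Serves the slacks d = 0 and d = 1, whose lower index 0 leaves nothing for Pascal's rule to add: a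
-- + 2 and a + 3 are out of reach for m steps, so the difference stays 1.
hits-difference-step : ∀ m {a} → m < 2 + a → hits m a ≡ 1 + hits m (1 + a) →
  hits (suc m) (suc a) ≡ suc m C 0 + hits (suc m) (2 + a)
hits-difference-step m {a} m<2+a eq = begin
  hits m a + hits m (2 + a)                             ≡⟨ cong₂ _+_ eq (hits-zero m<2+a) ⟩
  1 + hits m (1 + a) + 0                                ≡⟨ cong₂ (λ s t → s + hits m (1 + a) + t)
                                                             (sym (nC0≡1 (suc m)))
                                                             (sym (hits-zero (≤-trans m<2+a (n≤1+n (2 + a))))) ⟩
  suc m C 0 + hits m (1 + a) + hits m (3 + a)           ≡⟨ +-assoc (suc m C 0) (hits m (1 + a)) (hits m (3 + a)) ⟩
  suc m C 0 + (hits m (1 + a) + hits m (3 + a)) ∎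
  where open ≡-Reasoning

-- The difference counts the walks with maximum exactly a.
hits-difference : ∀ m {a d} → m ≡ a + d → hits m a ≡ m C ⌊ d /2⌋ + hits m (suc a)
hits-difference zero    {zero}  {zero} refl = refl
hits-difference (suc zero) {zero} {suc zero} refl = refl
-- At level 0 the recursion of `hits` does not apply. Instead one half of 2 ^ (m + 2) is expanded
-- twice, and `mid-symmetric` makes the two lower indices consecutive, as Pascal's rule requires.
hits-difference (suc (suc m)) {zero} {suc (suc m)} refl = begin
  2 ^ suc (suc m)
    ≡⟨ cong (_+_ (2 ^ suc m)) (+-identityʳ (2 ^ suc m)) ⟩
  2 ^ suc m + 2 ^ suc m
    ≡⟨ cong (_+ 2 ^ suc m) (hits-difference (suc m) {0} refl) ⟩
  suc m C ⌊ suc m /2⌋ + hits (suc m) 1 + 2 ^ suc m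
    ≡⟨ cong₂ (λ s t → s + t + 2 ^ suc m) (mid-symmetric (suc m)) (hits-difference (suc m) {1} refl) ⟩
  suc m C suc h + (suc m C h + hits (suc m) 2) + 2 ^ suc m
    ≡⟨ rearrange (suc m C h) (suc m C suc h) (hits (suc m) 2) (2 ^ suc m) ⟩
  suc m C h + suc m C suc h + (2 ^ suc m + hits (suc m) 2)
    ≡⟨ cong (_+ (2 ^ suc m + hits (suc m) 2)) (nCk+nC[k+1]≡[n+1]C[k+1] (suc m) h) ⟩
  suc (suc m) C suc h + hits (suc (suc m)) 1 ∎
  where
  open ≡-Reasoning
  h = ⌊ m /2⌋
  rearrange : ∀ p q r s → q + (p + r) + s ≡ p + q + (s + r)
  rearrange = solve-∀
hits-difference (suc m) {suc a} {zero} eq =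
  hits-difference-step m {a} (s≤s (≤-trans (≤-reflexive (trans (suc-injective eq) (+-identityʳ a))) (n≤1+n a)))
    (trans (hits-difference m {a} {0} (suc-injective eq)) (cong (_+ hits m (1 + a)) (nC0≡1 m)))
hits-difference (suc m) {suc a} {suc zero} eq =
  hits-difference-step m {a} (s≤s (≤-reflexive (trans (suc-injective eq) (+-comm a 1))))
    (trans (hits-difference m {a} {1} (suc-injective eq)) (cong (_+ hits m (1 + a)) (nC0≡1 m)))
hits-difference (suc m) {suc a} {suc (suc d)} eq = begin
  hits m a + hits m (2 + a)
    ≡⟨ cong₂ _+_ (hits-difference m {a} (suc-injective eq))
                 (hits-difference m {2 + a} {d} (trans (suc-injective eq) (trans (+-suc a (suc d)) (cong suc (+-suc a d))))) ⟩
  m C suc h + hits m (1 + a) + (m C h + hits m (3 + a))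
    ≡⟨ rearrange (m C suc h) (hits m (1 + a)) (m C h) (hits m (3 + a)) ⟩
  m C h + m C suc h + (hits m (1 + a) + hits m (3 + a))
    ≡⟨ cong (_+ hits (suc m) (2 + a)) (nCk+nC[k+1]≡[n+1]C[k+1] m h) ⟩
  suc m C suc h + hits (suc m) (2 + a) ∎
  where
  open ≡-Reasoning
  h = ⌊ d /2⌋
  rearrange : ∀ p q r s → p + q + (r + s) ≡ r + p + (q + s)
  rearrange = solve-∀

length-filter-split : ∀ {A : Set} {P Q R : Pred A 0ℓ}
  (P? : U.Decidable P) (Q? : U.Decidable Q) (R? : U.Decidable R) →
  Q U.⊆ P → R U.⊆ P → P U.⊆ Q U.∪ R → (∀ {x} → Q x → ¬ R x) →
  ∀ xs → length (filter P? xs) ≡ length (filter Q? xs) + length (filter R? xs)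
length-filter-split P? Q? R? Q⊆P R⊆P P⊆Q∪R disjoint = go
  where
  go : ∀ xs → length (filter P? xs) ≡ length (filter Q? xs) + length (filter R? xs)
  go []       = refl
  go (x ∷ xs) with P? x | Q? x | R? x
  ... | _     | yes q | yes r = contradiction r (disjoint q)
  ... | yes _ | yes _ | no _  = cong suc (go xs)
  ... | yes _ | no _  | yes _ = trans (cong suc (go xs)) (sym (+-suc _ _))
  ... | yes p | no ¬q | no ¬r = contradiction (P⊆Q∪R p) Sum.[ ¬q , ¬r ]
  ... | no ¬p | yes q | no _  = contradiction (Q⊆P q) ¬p
  ... | no ¬p | no _  | yes r = contradiction (R⊆P r) ¬p
  ... | no _  | no _  | no _  = go xs

-- Peak exactly r means at least r but not at least r + 1; in the difference of the two counts the
-- common term `hits m (1 + r)` cancels. The addition on the left avoids truncated subtraction.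
count-peak : ∀ {m} r → m ≤ 2 * r →
  count {m} (λ v → peak 0 v ≟ r) + hits m (2 + r) ≡ hits m r
count-peak {m} r m≤ = +-cancelʳ-≡ (hits m (1 + r)) _ _ (begin
  c + hits m (2 + r) + hits m (1 + r)   ≡⟨ +-assoc c _ _ ⟩
  c + (hits m (2 + r) + hits m (1 + r)) ≡⟨ cong (_+_ c) (+-comm (hits m (2 + r)) _) ⟩
  c + (hits m (1 + r) + hits m (2 + r)) ≡⟨ cong (_+_ c) (≥-count (suc r) (≤-trans m≤ (*-monoʳ-≤ 2 (n≤1+n r)))) ⟨
  c + count {m} (λ v → suc r ≤? peak 0 v) ≡⟨ length-filter-split (λ v → r ≤? peak 0 v) (λ v → peak 0 v ≟ r)
       (λ v → suc r ≤? peak 0 v) (≤-reflexive ∘ sym) <⇒≤ (swap ∘ Sum.map₂ sym ∘ m≤n⇒m<n∨m≡n)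
       (λ e lt → <⇒≢ lt (sym e)) (words signs m) ⟨
  count {m} (λ v → r ≤? peak 0 v)       ≡⟨ ≥-count r m≤ ⟩
  hits m r + hits m (1 + r) ∎)
  where
  open ≡-Reasoning
  c = count {m} (λ v → peak 0 v ≟ r)
  ≥-count : ∀ r → m ≤ 2 * r → count {m} (λ v → r ≤? peak 0 v) ≡ hits m r + hits m (1 + r)
  ≥-count r m≤ = subst (λ t → count {m} (λ v → t ≤? peak 0 v) ≡ hits m r + hits m (suc t)) (+-identityʳ r)
    (count-peak≥ m r 0 (subst (λ t → m ≤ 2 * t) (sym (+-identityʳ r)) m≤))

-- The drop from `hits m r` to `hits m (2 + r)` is made of two consecutive drops, each a binomial
-- coefficient by `hits-difference`, with slacks d and d - 1.
count-peak-formula : ∀ d r → d < r →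
  count {r + d} (λ v → peak 0 v ≟ r)
    ≡ (r + d) C ⌊ d /2⌋ + binom (r + d) (+ ⌊ suc d /2⌋ -ℤ 1ℤ)
count-peak-formula d r d<r = +-cancelʳ-≡ (hits m (2 + r)) _ _ (begin
  count {m} (λ v → peak 0 v ≟ r) + hits m (2 + r)
    ≡⟨ count-peak r (+-monoʳ-≤ r (≤-trans (<⇒≤ d<r) (m≤m+n r 0))) ⟩
  hits m r ≡⟨ hits-difference m {r} refl ⟩
  m C ⌊ d /2⌋ + hits m (1 + r) ≡⟨ cong (_+_ (m C ⌊ d /2⌋)) (second d refl) ⟩
  m C ⌊ d /2⌋ + (binom m (+ ⌊ suc d /2⌋ -ℤ 1ℤ) + hits m (2 + r))
    ≡⟨ +-assoc (m C ⌊ d /2⌋) _ _ ⟨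
  m C ⌊ d /2⌋ + binom m (+ ⌊ suc d /2⌋ -ℤ 1ℤ) + hits m (2 + r) ∎)
  where
  open ≡-Reasoning
  m = r + d
  second : ∀ d → m ≡ r + d → hits m (1 + r) ≡ binom m (+ ⌊ suc d /2⌋ -ℤ 1ℤ) + hits m (2 + r)
  -- For d = 0 the lower index is -1, so the binomial is 0 by convention; both hit counts vanish
  -- because there are only r steps.
  second zero    eq = trans (hits-zero (s≤s m≤r)) (sym (hits-zero (s≤s (≤-trans m≤r (n≤1+n r)))))
    where m≤r = ≤-reflexive (trans eq (+-identityʳ r))
  second (suc d) eq = hits-difference m (trans eq (+-suc r d))

-- Walks and their heights

module _ {A B : Set} where

  any-─ : {P Q : Pred B 0ℓ} {ys : List B} → (∀ y → P y → ¬ Q y) →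
    (p : Any P ys) → Any Q ys → Any Q (ys ─ p)
  any-─ disjoint (here p)          (here q)  = contradiction q (disjoint _ p)
  any-─ disjoint (here p)          (there q) = q
  any-─ {ys = _ ∷ _ ∷ _} disjoint (there p) (here q)  = here q
  any-─ {ys = _ ∷ _ ∷ _} disjoint (there p) (there q) = there (any-─ disjoint p q)

  -- A pigeonhole principle for a relation: the partner of the head is removed from `ys`, and since
  -- no two members of `xs` share a partner, the later ones keep theirs.
  length-≤ : {R : A → B → Set} {xs : List A} {ys : List B} →
    All (λ x → Any (R x) ys) xs →
    AllPairs (λ x x′ → ∀ y → R x y → ¬ R x′ y) xs →
    length xs ≤ length ys
  length-≤ []       []                       = z≤n
  length-≤ {R = R} {xs = x ∷ _} {ys = ys} (p ∷ ps) (x# ∷ xs#) = subst (_ ≤_)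
    (sym (List.length-removeAt′ ys (Any.index p)))
    (s≤s (length-≤ (All.zipWith (λ (d , q) → any-─ {P = R x} d p q) (x# , ps)) xs#))

negate : ∀ {m} → Vec Bool m → Vec Bool m
negate = Vec.map not

negate-involutive : ∀ {m} (v : Vec Bool m) → negate (negate v) ≡ v
negate-involutive []      = refl
negate-involutive (b ∷ v) = cong₂ _∷_ (not-involutive b) (negate-involutive v)

-- The distances from the start of the walk down to its lowest point (depth) and
-- up to its highest point (top).
depth : ∀ {m} → Vec Bool m → ℕ
depth []          = 0
depth (true  ∷ v) = pred (depth v)
depth (false ∷ v) = suc (depth v)

top : ∀ {m} → Vec Bool m → ℕ
top v = depth (negate v)

span : ∀ {m} → Vec Bool m → ℕ
span v = depth v + top v

ups : ∀ {m} → Vec Bool m → ℕ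
ups []          = 0
ups (true  ∷ v) = suc (ups v)
ups (false ∷ v) = ups v

ups+downs : ∀ {m} (v : Vec Bool m) → ups v + ups (negate v) ≡ m
ups+downs []          = refl
ups+downs (true  ∷ v) = cong suc (ups+downs v)
ups+downs (false ∷ v) = trans (+-suc (ups v) _) (cong suc (ups+downs v))

peak≤ : ∀ {m} x (v : Vec Bool m) → peak x v ≤ x + ups v
peak≤ x []          = ≤-reflexive (sym (+-identityʳ x))
peak≤ x (true  ∷ v) = ≤-trans (peak≤ (suc x) v) (≤-reflexive (sym (+-suc x (ups v))))
peak≤ x (false ∷ v) = ⊔-lub (m≤m+n x (ups v))
  (≤-trans (peak≤ (pred x) v) (+-monoˡ-≤ (ups v) (pred[n]≤n {x})))

-- The greatest rise is at most the number of up steps and the greatest fall at most the number of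
-- down steps.
peak+peak-negate≤ : ∀ {m} (v : Vec Bool m) → peak 0 v + peak 0 (negate v) ≤ m
peak+peak-negate≤ v = ≤-trans (+-mono-≤ (peak≤ 0 v) (peak≤ 0 (negate v))) (≤-reflexive (ups+downs v))

shift-⊔ : ∀ x d z → (x ⊔ pred d) + suc z ≡ (suc x ⊔ d) + z
shift-⊔ x zero    z = trans (cong (_+ suc z) (⊔-identityʳ x)) (+-suc x z)
shift-⊔ x (suc d) z = +-suc (x ⊔ d) z

-- An up step, with `p` and `q` in place of the peaks of the remaining walk and of its mirror image.
-- This abstraction lets a down step use the same lemma with the two directions exchanged.
widen-step : ∀ x y d t p (q : ℕ → ℕ) → suc x ≤ p →
  (∀ y → (suc x ⊔ d) + (y ⊔ t) ≡ (suc x + y) ⊔ (p ⊔ q y)) →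
  (x ⊔ pred d) + (y ⊔ suc t) ≡ (x + y) ⊔ (p ⊔ (y ⊔ q (pred y)))
-- At the highest point so far the step widens the range from x to x + 1; `p` dominates both values,
-- so neither shows in the maximum.
widen-step x zero d t p q x<p ih = begin
  (x ⊔ pred d) + suc t         ≡⟨ shift-⊔ x d t ⟩
  (suc x ⊔ d) + t              ≡⟨ ih 0 ⟩
  (suc x + 0) ⊔ (p ⊔ q 0)      ≡⟨ m≤n⇒m⊔n≡n (≤-trans (≤-reflexive (+-identityʳ (suc x))) x<) ⟩
  p ⊔ q 0                      ≡⟨ m≤n⇒m⊔n≡n (≤-trans (≤-reflexive (+-identityʳ x)) (≤-trans (n≤1+n x) x<)) ⟨
  (x + 0) ⊔ (p ⊔ q 0) ∎
  where
  open ≡-Reasoning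
  x< : suc x ≤ p ⊔ q 0
  x< = ≤-trans x<p (m≤m⊔n p (q 0))
-- Below the highest point the range reached so far does not change. The new term suc y is the
-- mirror walk's current height, already covered by x + suc y.
widen-step x (suc y) d t p q x<p ih = begin
  (x ⊔ pred d) + suc (y ⊔ t)   ≡⟨ shift-⊔ x d (y ⊔ t) ⟩
  (suc x ⊔ d) + (y ⊔ t)        ≡⟨ ih y ⟩
  (suc x + y) ⊔ (p ⊔ q y)      ≡⟨ cong (_⊔ (p ⊔ q y)) (+-suc x y) ⟨
  (x + suc y) ⊔ (p ⊔ q y)      ≡⟨ cong (_⊔ (p ⊔ q y)) (m≥n⇒m⊔n≡m (m≤n+m (suc y) x)) ⟨
  (x + suc y) ⊔ suc y ⊔ (p ⊔ q y) ≡⟨ ⊔-assoc (x + suc y) (suc y) _ ⟩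
  (x + suc y) ⊔ (suc y ⊔ (p ⊔ q y)) ≡⟨ cong ((x + suc y) ⊔_) (swap-⊔ (suc y) p (q y)) ⟩
  (x + suc y) ⊔ (p ⊔ (suc y ⊔ q y)) ∎
  where
  open ≡-Reasoning
  swap-⊔ : ∀ a b c → a ⊔ (b ⊔ c) ≡ b ⊔ (a ⊔ c)
  swap-⊔ a b c = trans (sym (⊔-assoc a b c)) (trans (cong (_⊔ c) (⊔-comm a b)) (⊔-assoc b a c))

-- x and y are the distances to the lowest and highest point reached so far.
widen : ∀ {m} x y (v : Vec Bool m) →
  (x ⊔ depth v) + (y ⊔ top v) ≡ (x + y) ⊔ (peak x v ⊔ peak y (negate v))
widen x y []          = trans (cong₂ _+_ (⊔-identityʳ x) (⊔-identityʳ y))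
  (sym (m≥n⇒m⊔n≡m (⊔-lub (m≤m+n x y) (m≤n+m y x))))
widen x y (true  ∷ v) = widen-step x y (depth v) (top v) (peak (suc x) v) (λ y → peak y (negate v))
  (x≤peak (suc x) v) (λ y → widen (suc x) y v)
widen x y (false ∷ v) = begin
  (x ⊔ suc (depth v)) + (y ⊔ pred (top v)) ≡⟨ +-comm (x ⊔ suc (depth v)) _ ⟩
  (y ⊔ pred (top v)) + (x ⊔ suc (depth v))
    ≡⟨ widen-step y x (top v) (depth v) (peak (suc y) (negate v)) (λ x → peak x v)
         (x≤peak (suc y) (negate v)) ih ⟩
  (y + x) ⊔ (peak (suc y) (negate v) ⊔ (x ⊔ peak (pred x) v))
    ≡⟨ cong₂ _⊔_ (+-comm y x) (⊔-comm (peak (suc y) (negate v)) _) ⟩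
  (x + y) ⊔ ((x ⊔ peak (pred x) v) ⊔ peak (suc y) (negate v)) ∎
  where
  open ≡-Reasoning
  ih : ∀ x → (suc y ⊔ top v) + (x ⊔ depth v) ≡ (suc y + x) ⊔ (peak (suc y) (negate v) ⊔ peak x v)
  ih x = trans (+-comm (suc y ⊔ top v) _) (trans (widen x (suc y) v)
    (cong₂ _⊔_ (+-comm x (suc y)) (⊔-comm (peak x v) _)))

-- If a lowest point comes before a highest one, the span is a rise, otherwise a fall; no rise or
-- fall exceeds the span.
span-peaks : ∀ {m} (v : Vec Bool m) → span v ≡ peak 0 v ⊔ peak 0 (negate v)
span-peaks v = widen 0 0 v

span≤ : ∀ {m} (v : Vec Bool m) → span v ≤ m
span≤ v = ≤-trans (≤-reflexive (span-peaks v)) (≤-trans (m⊔n≤m+n (peak 0 v) _) (peak+peak-negate≤ v))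

span-negate : ∀ {m} (v : Vec Bool m) → span (negate v) ≡ span v
span-negate v = trans (cong (_+_ (top v)) (cong depth (negate-involutive v))) (+-comm (top v) (depth v))

step : Bool → ℕ → ℕ
step true  = suc
step false = pred

-- Meaningful only for depth v ≤ s; otherwise pred truncates a step below 0.
heights : ∀ {m} → ℕ → Vec Bool m → Vec ℕ (suc m)
heights s []      = s ∷ []
heights s (b ∷ v) = s ∷ heights (step b s) v

height : ∀ {m} → ℕ → Vec Bool m → Fin (suc m) → ℕ
height s v = lookup (heights s v)

height-zero : ∀ {m} s (v : Vec Bool m) → height s v zero ≡ s
height-zero s []      = refl
height-zero s (b ∷ v) = refl

pred≤⇒≤suc : ∀ {d s} → pred d ≤ s → d ≤ suc s
pred≤⇒≤suc {zero}  _ = z≤n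
pred≤⇒≤suc {suc d} p = s≤s p

height-translate : ∀ {m} {s s′} (v : Vec Bool m) → depth v ≤ s → depth v ≤ s′ → ∀ i →
  height s v i + s′ ≡ height s′ v i + s
height-translate {s = s} {s′} []          _ _ zero    = +-comm s s′
height-translate {s = s} {s′} (true  ∷ v) _ _ zero    = +-comm s s′
height-translate {s = s} {s′} (true  ∷ v) d≤s d≤s′ (suc i) =
  suc-injective (trans (sym (+-suc (height (suc s) v i) s′))
    (trans (height-translate v (pred≤⇒≤suc d≤s) (pred≤⇒≤suc d≤s′) i) (+-suc (height (suc s′) v i) s)))
height-translate {s = s} {s′} (false ∷ v) _ _ zero    = +-comm s s′
height-translate {s = suc s} {suc s′} (false ∷ v) (s≤s d≤s) (s≤s d≤s′) (suc i) =
  trans (+-suc _ s′) (trans (cong suc (height-translate v d≤s d≤s′ i)) (sym (+-suc _ s)))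

-- A walk and its mirror image move oppositely, so the sum of their heights is constant; the two
-- bounds keep `pred` from truncating in either.
height-reflect : ∀ {m} {s s′} (v : Vec Bool m) → depth v ≤ s → top v ≤ s′ → ∀ i →
  height s v i + height s′ (negate v) i ≡ s + s′
height-reflect []          _ _ zero = refl
height-reflect (true  ∷ v) _ _ zero = refl
height-reflect {s = s} {suc s′} (true  ∷ v) d≤s (s≤s t≤s′) (suc i) =
  trans (height-reflect v (pred≤⇒≤suc d≤s) t≤s′ i) (sym (+-suc s s′))
height-reflect (false ∷ v) _ _ zero = refl
height-reflect {s = suc s} {s′} (false ∷ v) (s≤s d≤s) t≤s′ (suc i) =
  trans (height-reflect v d≤s (pred≤⇒≤suc t≤s′) i) (+-suc s s′)

-- The mirror image started at `top v` has natural heights, and these complement the heights of `v`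
-- to s + `top v`.
height-upper : ∀ {m} {s} (v : Vec Bool m) → depth v ≤ s → ∀ i → height s v i ≤ s + top v
height-upper {s = s} v d≤s i = ≤-trans (m≤m+n _ (height (top v) (negate v) i))
  (≤-reflexive (height-reflect v d≤s ≤-refl i))

height-lower : ∀ {m} {s} (v : Vec Bool m) → depth v ≤ s → ∀ i → s ≤ height s v i + depth v
height-lower {s = s} v d≤s i = ≤-trans (m≤n+m s _) (≤-reflexive
  (sym (height-translate v d≤s ≤-refl i)))

-- A discrete intermediate value theorem: a value other than the start stays within the range of the
-- remaining walk.
height-surjective : ∀ {m} {s} (v : Vec Bool m) → depth v ≤ s →
  ∀ z → s ≤ z + depth v → z ≤ s + top v → ∃ λ i → height s v i ≡ z
height-surjective {s = s} v d≤s z lo hi with z ≟ s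
height-surjective {s = s} v           d≤s z lo hi | yes refl = zero , height-zero s v
height-surjective {s = s} []          d≤s z lo hi | no z≢s =
  contradiction (≤-antisym (subst (z ≤_) (+-identityʳ s) hi) (subst (s ≤_) (+-identityʳ z) lo)) z≢s
height-surjective {s = s} (true  ∷ v) d≤s z lo hi | no z≢s =
  let i , eq = height-surjective v (pred≤⇒≤suc d≤s) z (lower (depth v) lo) (subst (z ≤_) (+-suc s _) hi)
  in suc i , eq
  where
  lower : ∀ d → s ≤ z + pred d → suc s ≤ z + d
  -- The start is a lowest point and the rest of the walk never returns to it, so its range begins
  -- one higher; z ≢ s supplies the missing unit.
  lower zero    p = ≤-trans (≤∧≢⇒< (subst (s ≤_) (+-identityʳ z) p) (z≢s ∘ sym)) (m≤m+n z 0)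
  lower (suc d) p = subst (suc s ≤_) (sym (+-suc z d)) (s≤s p)
height-surjective {s = suc s} (false ∷ v) (s≤s d≤s) z lo hi | no z≢s =
  let i , eq = height-surjective v d≤s z (s≤s⁻¹ (subst (suc s ≤_) (+-suc z _) lo)) (upper (top v) hi)
  in suc i , eq
  where
  upper : ∀ t → z ≤ suc s + pred t → z ≤ s + t
  upper zero    p = ≤-trans (s≤s⁻¹ (≤∧≢⇒< (subst (z ≤_) (+-identityʳ (suc s)) p) z≢s)) (m≤m+n s 0)
  upper (suc t) p = subst (z ≤_) (sym (+-suc s t)) p

-- Opposite steps cancel and equal steps move by two. Hence the kernel records every change of
-- direction.
turn : ∀ {m} {s} b c (v : Vec Bool m) → depth (b ∷ c ∷ v) ≤ s →
  height s (b ∷ c ∷ v) zero ≡ height s (b ∷ c ∷ v) (suc (suc zero)) ⇔ b ≡ not c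
turn {s = s} true  true  v d≤s rewrite height-zero (suc (suc s)) v =
  mk⇔ (λ eq → contradiction eq (<⇒≢ (m≤n+m (suc s) 1))) λ ()
turn {s = s} true  false v d≤s rewrite height-zero s v = mk⇔ (λ _ → refl) (λ _ → refl)
turn {s = suc s} false true v d≤s rewrite height-zero (suc s) v = mk⇔ (λ _ → refl) (λ _ → refl)
turn {s = suc (suc s)} false false v (s≤s d≤s) rewrite height-zero s v =
  mk⇔ (λ eq → contradiction (sym eq) (<⇒≢ (m≤n+m (suc s) 1))) λ ()

depth-tail : ∀ {m} {s} b (v : Vec Bool m) → depth (b ∷ v) ≤ s → depth v ≤ step b s
depth-tail true  v p       = pred≤⇒≤suc p
depth-tail false v (s≤s p) = p

SameKernel : {A B I : Set} → (I → A) → (I → B) → Set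
SameKernel f g = ∀ i j → f i ≡ f j ⇔ g i ≡ g j

same-turn : ∀ b b′ c → b ≡ not c ⇔ b′ ≡ not c → b ≡ b′
same-turn true  true  c     _ = refl
same-turn false false c     _ = refl
same-turn true  false true  e = Equivalence.from e refl
same-turn true  false false e = sym (Equivalence.to e refl)
same-turn false true  true  e = sym (Equivalence.to e refl)
same-turn false true  false e = Equivalence.from e refl

opposite-turn : ∀ b b′ c → b ≡ not (not c) ⇔ b′ ≡ not c → b ≡ not b′
opposite-turn b b′ c e = same-turn b (not b′) (not c)
  (⇔-trans e (mk⇔ (cong not) (not-injective {b′})))

-- Induction from the end of the walk: the tails agree up to sign, and whether there is a turn at
-- the second vertex fixes the first step relative to the second, hence with the same sign.
steps-from-kernel : ∀ {m} {s s′} (v w : Vec Bool m) → depth v ≤ s → depth w ≤ s′ →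
  SameKernel (height s v) (height s′ w) → v ≡ w ⊎ v ≡ negate w
steps-from-kernel []          []          _ _ _ = inj₁ refl
steps-from-kernel (true  ∷ []) (true  ∷ []) _ _ _ = inj₁ refl
steps-from-kernel (true  ∷ []) (false ∷ []) _ _ _ = inj₂ refl
steps-from-kernel (false ∷ []) (true  ∷ []) _ _ _ = inj₂ refl
steps-from-kernel (false ∷ []) (false ∷ []) _ _ _ = inj₁ refl
steps-from-kernel {s = s} {s′} (b ∷ c ∷ v) (b′ ∷ c′ ∷ w) d≤s d≤s′ same =
  Sum.map (λ { refl → cong (_∷ c ∷ v) (same-turn b b′ c turns) })
          (λ { refl → cong (_∷ c ∷ v) (opposite-turn b b′ c′ turns) })
    (steps-from-kernel (c ∷ v) (c′ ∷ w) (depth-tail b (c ∷ v) d≤s) (depth-tail b′ (c′ ∷ w) d≤s′)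
      (λ i j → same (suc i) (suc j)))
  where
  turns : b ≡ not c ⇔ b′ ≡ not c′
  turns = ⇔-trans (⇔-sym (turn b c v d≤s)) (⇔-trans (same zero (suc (suc zero))) (turn b′ c′ w d≤s′))

-- Partitions induced by endomorphisms

∈-fibre⁺ : ∀ {n} (f : SelfMap n) {y} i → lookup f i ≡ y → i ∈ fibre f y
∈-fibre⁺ f {y} i eq = Vec.lookup⇒[]= i (fibre f y) (trans (Vec.lookup-map i _ f) does≡true)
  where
  does≡true : does (lookup f i Fin.≟ y) ≡ true
  does≡true with lookup f i Fin.≟ y
  ... | yes _ = refl
  ... | no ≢y = contradiction eq ≢y

∈-fibre⁻ : ∀ {n} (f : SelfMap n) {y} i → i ∈ fibre f y → lookup f i ≡ y
∈-fibre⁻ f {y} i i∈ with lookup f i Fin.≟ y | trans (sym (Vec.lookup-map i (λ z → does (z Fin.≟ y)) f)) (Vec.[]=⇒lookup i∈)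
... | yes eq | _ = eq

∈-induced⁺ : ∀ {n} (f : SelfMap n) i → fibre f (lookup f i) List.∈ induced f
∈-induced⁺ f i = ∈-filter⁺ nonempty? (∈-map⁺ (fibre f) (∈-allFin (lookup f i))) (i , ∈-fibre⁺ f i refl)

∈-induced⁻ : ∀ {n} (f : SelfMap n) {p} → p List.∈ induced f → ∃ λ i → p ≡ fibre f (lookup f i)
∈-induced⁻ {n} f p∈ with ∈-filter⁻ nonempty? {xs = map (fibre f) (allFin n)} p∈
... | p∈map , i , i∈p with ∈-map⁻ (fibre f) p∈map
... | y , _ , refl = i , cong (fibre f) (sym (∈-fibre⁻ f i i∈p))

-- The block of i under f contains j and is also a block of g.
induced-⊆⁻ : ∀ {n} (f g : SelfMap n) → induced f List⊆.⊆ induced g →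
  ∀ {i j} → lookup f i ≡ lookup f j → lookup g i ≡ lookup g j
induced-⊆⁻ f g f⊆g {i} {j} fi≡fj with ∈-induced⁻ g (f⊆g (∈-induced⁺ f i))
... | k , eq = trans (∈-fibre⁻ g i (subst (i ∈_) eq (∈-fibre⁺ f i refl)))
                (sym (∈-fibre⁻ g j (subst (j ∈_) eq (∈-fibre⁺ f j (sym fi≡fj)))))

induced-≈⁻ : ∀ {n} (f g : SelfMap n) → induced f ≈ induced g → SameKernel (lookup f) (lookup g)
induced-≈⁻ f g (f⊆g , g⊆f) i j = mk⇔ (induced-⊆⁻ f g f⊆g) (induced-⊆⁻ g f g⊆f)

SameKernel-sym : {A B I : Set} {f : I → A} {g : I → B} → SameKernel f g → SameKernel g f
SameKernel-sym same i j = ⇔-sym (same i j)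

SameKernel-trans : {A B C I : Set} {f : I → A} {g : I → B} {h : I → C} →
  SameKernel f g → SameKernel g h → SameKernel f h
SameKernel-trans same same′ i j = ⇔-trans (same i j) (same′ i j)

fibre-⊆ : ∀ {n} (f g : SelfMap n) → SameKernel (lookup f) (lookup g) →
  ∀ i {j} → j ∈ fibre f (lookup f i) → j ∈ fibre g (lookup g i)
fibre-⊆ f g same i {j} j∈ = ∈-fibre⁺ g j (Equivalence.to (same j i) (∈-fibre⁻ f j j∈))

induced-⊆⁺ : ∀ {n} (f g : SelfMap n) → SameKernel (lookup f) (lookup g) → induced f List⊆.⊆ induced g
induced-⊆⁺ f g same p∈ with ∈-induced⁻ f p∈
... | i , refl = subst (List._∈ induced g)
  (⊆-antisym (λ {_} → fibre-⊆ g f (SameKernel-sym same) i) (λ {_} → fibre-⊆ f g same i)) (∈-induced⁺ g i)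

induced-≈⁺ : ∀ {n} (f g : SelfMap n) → SameKernel (lookup f) (lookup g) → induced f ≈ induced g
induced-≈⁺ f g same = induced-⊆⁺ f g same , induced-⊆⁺ g f (SameKernel-sym same)

≈-decSetoid : ℕ → DecSetoid 0ℓ 0ℓ
≈-decSetoid n = record
  { Carrier = Blocks n
  ; _≈_     = _≈_
  ; isDecEquivalence = record
    { isEquivalence = record
      { refl  = id , id
      ; sym   = λ (ρ⊆σ , σ⊆ρ) → σ⊆ρ , ρ⊆σ
      ; trans = λ (ρ⊆σ , σ⊆ρ) (σ⊆τ , τ⊆σ) → σ⊆τ ∘ ρ⊆σ , σ⊆ρ ∘ τ⊆σ
      }
    ; _≟_ = _≈?_
    }
  }

record Realises {m} (f : SelfMap (suc m)) (s : ℕ) (v : Vec Bool m) : Set where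
  field
    depth≤   : depth v ≤ s
    heights≡ : ∀ i → toℕ (lookup f i) ≡ height s v i

open Realises

realises-kernel : ∀ {m} {f : SelfMap (suc m)} {s v} → Realises f s v → SameKernel (lookup f) (height s v)
realises-kernel {f = f} R i j = mk⇔
  (λ eq → trans (sym (heights≡ R i)) (trans (cong toℕ eq) (heights≡ R j)))
  (λ eq → Fin.toℕ-injective (trans (heights≡ R i) (trans eq (sym (heights≡ R j)))))

realises-≈⁻ : ∀ {m} {f g : SelfMap (suc m)} {s s′ v w} → Realises f s v → Realises g s′ w →
  induced f ≈ induced g → v ≡ w ⊎ v ≡ negate w
realises-≈⁻ {f = f} {g} {v = v} {w} Rf Rg f≈g = steps-from-kernel v w (depth≤ Rf) (depth≤ Rg)
  (SameKernel-trans (SameKernel-sym (realises-kernel Rf))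
    (SameKernel-trans (induced-≈⁻ f g f≈g) (realises-kernel Rg)))

translate-kernel : ∀ {m} {s s′} (v : Vec Bool m) → depth v ≤ s → depth v ≤ s′ →
  SameKernel (height s v) (height s′ v)
translate-kernel {s = s} {s′} v d≤s d≤s′ i j = mk⇔ (same d≤s d≤s′) (same d≤s′ d≤s)
  where
  same : ∀ {s s′} → depth v ≤ s → depth v ≤ s′ →
    height s v i ≡ height s v j → height s′ v i ≡ height s′ v j
  same {s} {s′} p q eq = +-cancelʳ-≡ s _ _
    (trans (sym (height-translate v p q i)) (trans (cong (_+ s′) eq) (height-translate v p q j)))

reflect-kernel : ∀ {m} {s s′} (v : Vec Bool m) → depth v ≤ s → top v ≤ s′ →
  SameKernel (height s v) (height s′ (negate v))
reflect-kernel {s = s} {s′} v d≤s t≤s′ i j = mk⇔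
  (λ eq → +-cancelˡ-≡ (height s v i) _ _
    (trans sums (cong (_+ height s′ (negate v) j) (sym eq))))
  (λ eq → +-cancelʳ-≡ (height s′ (negate v) i) _ _
    (trans sums (cong (_+_ (height s v j)) (sym eq))))
  where
  sums : height s v i + height s′ (negate v) i ≡ height s v j + height s′ (negate v) j
  sums = trans (height-reflect v d≤s t≤s′ i) (sym (height-reflect v d≤s t≤s′ j))

realises-≈⁺ : ∀ {m} {f g : SelfMap (suc m)} {s s′ v w} → Realises f s v → Realises g s′ w →
  w ≡ v ⊎ w ≡ negate v → induced f ≈ induced g
realises-≈⁺ {f = f} {g} {v = v} Rf Rg (inj₁ refl) = induced-≈⁺ f g
  (SameKernel-trans (realises-kernel Rf)
    (SameKernel-trans (translate-kernel v (depth≤ Rf) (depth≤ Rg)) (SameKernel-sym (realises-kernel Rg))))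
realises-≈⁺ {f = f} {g} {v = v} Rf Rg (inj₂ refl) = induced-≈⁺ f g
  (SameKernel-trans (realises-kernel Rf)
    (SameKernel-trans (reflect-kernel v (depth≤ Rf) (depth≤ Rg)) (SameKernel-sym (realises-kernel Rg))))

-- Endomorphisms as walks

IsWalk : ∀ {m} → Vec ℕ m → Set
IsWalk hs = ∀ i j → toℕ j ≡ suc (toℕ i) → ∣ lookup hs i - lookup hs j ∣ ≡ 1

∣n-1+n∣≡1 : ∀ n → ∣ n - suc n ∣ ≡ 1
∣n-1+n∣≡1 zero    = refl
∣n-1+n∣≡1 (suc n) = ∣n-1+n∣≡1 n

adjacent⇒ : ∀ a b → ∣ a - b ∣ ≡ 1 → b ≡ suc a ⊎ a ≡ suc b
adjacent⇒ zero    (suc zero) refl = inj₁ refl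
adjacent⇒ (suc zero) zero    refl = inj₂ refl
adjacent⇒ (suc a) (suc b)    eq   = Sum.map (cong suc) (cong suc) (adjacent⇒ a b eq)

step-adjacent : ∀ {m} {s} b (v : Vec Bool m) → depth (b ∷ v) ≤ s → ∣ s - step b s ∣ ≡ 1
step-adjacent {s = s}     true  v _ = ∣n-1+n∣≡1 s
step-adjacent {s = suc s} false v _ = trans (∣-∣-comm (suc s) s) (∣n-1+n∣≡1 s)

heights-isWalk : ∀ {m} {s} (v : Vec Bool m) → depth v ≤ s → IsWalk (heights s v)
heights-isWalk {s = s} (b ∷ v) d≤s zero (suc zero) refl =
  trans (cong (∣ s -_∣) (height-zero (step b s) v)) (step-adjacent b v d≤s)
heights-isWalk (b ∷ v) d≤s (suc i) (suc j) eq =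
  heights-isWalk v (depth-tail b v d≤s) i j (suc-injective eq)

walk-heights : ∀ {m} s (hs : Vec ℕ m) → IsWalk (s ∷ hs) →
  ∃ λ v → depth v ≤ s × s ∷ hs ≡ heights s v
walk-heights s []       walk = [] , z≤n , refl
walk-heights s (h ∷ hs) walk
  with walk-heights h hs (λ i j eq → walk (suc i) (suc j) (cong suc eq)) | adjacent⇒ s h (walk zero (suc zero) refl)
... | v , d≤h , eq | inj₁ refl = true ∷ v , pred-mono-≤ d≤h , cong (s ∷_) eq
... | v , d≤h , eq | inj₂ refl = false ∷ v , s≤s d≤h , cong (suc h ∷_) eq

realises⇒endomorphism : ∀ {m} {f : SelfMap (suc m)} {s v} → Realises f s v → IsEndomorphism f
realises⇒endomorphism {v = v} R i j eq =
  trans (cong₂ ∣_-_∣ (heights≡ R i) (heights≡ R j)) (heights-isWalk v (depth≤ R) i j eq)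

endomorphism⇒realises : ∀ {m} (f : SelfMap (suc m)) → IsEndomorphism f → ∃₂ λ s v → Realises f s v
endomorphism⇒realises f@(x ∷ xs) endo
  with v , d≤s , eq ← walk-heights (toℕ x) (Vec.map toℕ xs) (λ i j e → trans
         (cong₂ ∣_-_∣ (Vec.lookup-map i toℕ f) (Vec.lookup-map j toℕ f)) (endo i j e))
  = toℕ x , v , record
    { depth≤   = d≤s
    ; heights≡ = λ i → trans (sym (Vec.lookup-map i toℕ f)) (cong (λ hs → lookup hs i) eq)
    }

-- Truncates a height above m, which canonical never passes to it.
clamp : ∀ {m} → ℕ → Fin (suc m)
clamp {m} z = fromℕ< {z ⊓ m} (s≤s (m⊓n≤n z m))

-- Starting at `depth v` puts the lowest height at 0; as the span is at most m, the walk then fits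
-- into the path.
canonical : ∀ {m} → Vec Bool m → SelfMap (suc m)
canonical v = Vec.map clamp (heights (depth v) v)

canonical-realises : ∀ {m} (v : Vec Bool m) → Realises (canonical v) (depth v) v
canonical-realises {m} v = record
  { depth≤   = ≤-refl
  ; heights≡ = λ i → begin
      toℕ (lookup (canonical v) i) ≡⟨ cong toℕ (Vec.lookup-map i clamp (heights (depth v) v)) ⟩
      toℕ (clamp (height (depth v) v i)) ≡⟨ Fin.toℕ-fromℕ< _ ⟩
      height (depth v) v i ⊓ m ≡⟨ m≤n⇒m⊓n≡m (≤-trans (height-upper v ≤-refl i) (span≤ v)) ⟩
      height (depth v) v i ∎
  }
  where open ≡-Reasoning

-- Blocks correspond to attained values, which fill an interval of `span v` + 1 integers. The two
-- lists are compared by `length-≤` in both directions.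
length-induced : ∀ {m} {f : SelfMap (suc m)} {s v} → Realises f s v → length (induced f) ≡ suc (span v)
length-induced {m} {f} {s} {v} R = begin
  length (induced f)       ≡⟨ length-filter-map nonempty? (fibre f) (allFin (suc m)) ⟩
  length values            ≡⟨ ≤-antisym values≤ values≥ ⟩
  length (upTo (suc (span v))) ≡⟨ List.length-upTo (suc (span v)) ⟩
  suc (span v) ∎
  where
  open ≡-Reasoning
  values : List (Fin (suc m))
  values = filter (λ y → nonempty? (fibre f y)) (allFin (suc m))

  -- The lowest height of the walk.
  base = s ∸ depth v

  base+depth : base + depth v ≡ s
  base+depth = m∸n+n≡m (depth≤ R)

  base+span : base + span v ≡ s + top v
  base+span = trans (sym (+-assoc base (depth v) (top v))) (cong (_+ top v) base+depth)

  At : Fin (suc m) → ℕ → Set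
  At y t = toℕ y ≡ base + t

  value-in-range : ∀ {y} → y List.∈ values → Any (At y) (upTo (suc (span v)))
  value-in-range {y} y∈ with ∈-filter⁻ (λ y → nonempty? (fibre f y)) {xs = allFin (suc m)} y∈
  ... | _ , i , i∈ = List.lose (∈-upTo⁺ (s≤s t≤span)) (sym (m+[n∸m]≡n base≤y))
    where
    y≡height : toℕ y ≡ height s v i
    y≡height = trans (cong toℕ (sym (∈-fibre⁻ f i i∈))) (heights≡ R i)
    base≤y : base ≤ toℕ y
    base≤y = +-cancelʳ-≤ (depth v) base (toℕ y)
      (subst₂ _≤_ (sym base+depth) (cong (_+ depth v) (sym y≡height)) (height-lower v (depth≤ R) i))
    t≤span : toℕ y ∸ base ≤ span v
    t≤span = m≤n+o⇒m∸n≤o (toℕ y) base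
      (subst₂ _≤_ (sym y≡height) (sym base+span) (height-upper v (depth≤ R) i))

  range-has-value : ∀ {t} → t List.∈ upTo (suc (span v)) → Any (λ y → At y t) values
  range-has-value {t} t∈
    with i , eq ← height-surjective v (depth≤ R) (base + t)
      (subst (_≤ base + t + depth v) base+depth (+-monoˡ-≤ (depth v) (m≤m+n base t)))
      (subst (base + t ≤_) base+span (+-monoʳ-≤ base (s≤s⁻¹ (∈-upTo⁻ t∈))))
    = List.lose
        (∈-filter⁺ (λ y → nonempty? (fibre f y)) (∈-allFin (lookup f i)) (i , ∈-fibre⁺ f i refl))
        (trans (heights≡ R i) eq)

  values≤ : length values ≤ length (upTo (suc (span v)))
  values≤ = length-≤ (All.tabulate value-in-range)
    (AllPairs.map (λ y≢y′ t eq eq′ → y≢y′ (Fin.toℕ-injective (trans eq (sym eq′))))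
      (Unique.filter⁺ (λ y → nonempty? (fibre f y)) (Unique.allFin⁺ (suc m))))

  values≥ : length (upTo (suc (span v))) ≤ length values
  values≥ = length-≤ {R = λ t y → At y t} (All.tabulate range-has-value)
    (AllPairs.map (λ t≢t′ y eq eq′ → t≢t′ (+-cancelˡ-≡ base _ _ (trans (sym eq) eq′)))
      (Unique.upTo⁺ (suc (span v))))

-- Matching partitions with words

∈-words : ∀ {A : Set} {xs : List A} → (∀ x → x List.∈ xs) → ∀ {m} (v : Vec A m) → v List.∈ words xs m
∈-words all []      = here refl
∈-words all (x ∷ v) = ∈-cartesianProductWith⁺ _∷_ (all x) (∈-words all v)

words-unique : ∀ {A : Set} {xs : List A} → Unique xs → ∀ m → Unique (words xs m)
words-unique xs! zero    = [] ∷ []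
words-unique xs! (suc m) = Unique.cartesianProductWith⁺ _∷_ Vec.∷-injective xs! (words-unique xs! m)

∈-signs : ∀ b → b List.∈ signs
∈-signs true  = here refl
∈-signs false = there (here refl)

signs-unique : Unique signs
signs-unique = ((λ ()) ∷ []) ∷ [] ∷ []

∈-endomorphisms⁺ : ∀ {n} (f : SelfMap n) → IsEndomorphism f → f List.∈ endomorphisms n
∈-endomorphisms⁺ {n} f endo = ∈-filter⁺ isEndomorphism? (∈-words ∈-allFin f) endo

∈-𝒞⁻ : ∀ {m} {ρ} → ρ List.∈ 𝒞 (suc m) → ∃ λ f → ρ ≡ induced f × ∃₂ λ s v → Realises {m} f s v
∈-𝒞⁻ {m} {ρ} ρ∈
  with f , f∈ , refl ← ∈-map⁻ induced (∈-deduplicate⁻ _≈?_ (map induced (endomorphisms (suc m))) ρ∈)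
  with _ , endo ← ∈-filter⁻ isEndomorphism? {xs = words (allFin (suc m)) (suc m)} f∈
  = f , refl , endomorphism⇒realises f endo

𝒞-complete : ∀ {n} (f : SelfMap n) → IsEndomorphism f → Any (_≈ induced f) (𝒞 n)
𝒞-complete {n} f endo = Any.deduplicate⁺ _≈?_ (λ σ≈ρ ρ≈f → ≈.trans σ≈ρ ρ≈f)
  (List.lose (∈-map⁺ induced (∈-endomorphisms⁺ f endo)) ≈.refl)
  where module ≈ = DecSetoid (≈-decSetoid n)

allPairs-both : {A : Set} {P : Pred A 0ℓ} {R : A → A → Set} {xs : List A} →
  All P xs → AllPairs R xs → AllPairs (λ x y → P x × P y × R x y) xs
allPairs-both []       []       = []
allPairs-both (p ∷ ps) (r ∷ rs) = All.zipWith (λ (q , r) → p , q , r) (ps , r) ∷ allPairs-both ps rs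

-- A partition determines its word up to sign, and m < 2 r lets exactly one choice of sign have peak
-- r when there are r + 1 blocks. The relation between a partition and the partition of
-- `canonical v` matches the two lists in both directions.
l-count : ∀ m r → m < 2 * r →
  length (filter (λ ρ → length ρ ≟ suc r) (𝒞 (suc m))) ≡ count {m} (λ v → peak 0 v ≟ r)
l-count m r m<2r = ≤-antisym
  (length-≤ {R = λ ρ v → ρ ≈ induced (canonical v)} (All.tabulate has-word)
    (AllPairs.map (λ ρ≉σ v ρ≈v σ≈v → ρ≉σ (≈.trans ρ≈v (≈.sym σ≈v)))
      (AllPairs.filter⁺ P? (UniqueDec.deduplicate-! (≈-decSetoid (suc m)) (map induced (endomorphisms (suc m)))))))
  (length-≤ {R = λ v ρ → ρ ≈ induced (canonical v)} (All.tabulate has-partition)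
    (AllPairs.map (λ {v} {w} (v≡r , w≡r , v≢w) ρ ρ≈v ρ≈w →
        -- Two words of one partition are equal or opposite; opposite ones would need r up steps and
        -- r down steps, more than m in all.
        Sum.[ v≢w , (λ v≡-w → peaks-exclusive w w≡r (trans (cong (peak 0) (sym v≡-w)) v≡r)) ]
          (realises-≈⁻ (canonical-realises v) (canonical-realises w) (≈.trans (≈.sym ρ≈v) ρ≈w)))
      (allPairs-both (All.all-filter (λ v → peak 0 v ≟ r) (words signs m))
        (Unique.filter⁺ (λ v → peak 0 v ≟ r) (words-unique signs-unique m)))))
  where
  module ≈ = DecSetoid (≈-decSetoid (suc m))
  P? = λ (ρ : Blocks (suc m)) → length ρ ≟ suc r
  ws = filter (λ v → peak 0 v ≟ r) (words signs m)

  peaks-exclusive : ∀ v → peak 0 v ≡ r → peak 0 (negate v) ≢ r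
  peaks-exclusive v eq eq′ = <⇒≱ m<2r (≤-trans
    (≤-reflexive (trans (cong (_+_ r) (+-identityʳ r)) (cong₂ _+_ (sym eq) (sym eq′))))
    (peak+peak-negate≤ v))

  ∈-ws : ∀ {v} → peak 0 v ≡ r → v List.∈ ws
  ∈-ws {v} eq = ∈-filter⁺ (λ v → peak 0 v ≟ r) (∈-words ∈-signs v) eq

  span≡ : ∀ {v} → peak 0 v ≡ r → span v ≡ r
  span≡ {v} eq = trans (span-peaks v) (trans (cong (_⊔ peak 0 (negate v)) eq) (m≥n⇒m⊔n≡m (+-cancelˡ-≤ r _ _
    (≤-trans (subst (λ t → t + peak 0 (negate v) ≤ m) eq (peak+peak-negate≤ v))
      (≤-trans (<⇒≤ m<2r) (≤-reflexive (cong (_+_ r) (+-identityʳ r))))))))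

  has-word : ∀ {ρ} → ρ List.∈ filter P? (𝒞 (suc m)) → Any (λ v → ρ ≈ induced (canonical v)) ws
  has-word ρ∈
    with ρ∈𝒞 , length≡ ← ∈-filter⁻ P? {xs = 𝒞 (suc m)} ρ∈
    with f , refl , s , v , R ← ∈-𝒞⁻ ρ∈𝒞
    with span-v ← suc-injective (trans (sym (length-induced R)) length≡)
    with ⊔-sel (peak 0 v) (peak 0 (negate v))
  ... | inj₁ eq = List.lose (∈-ws {v} (trans (sym eq) (trans (sym (span-peaks v)) span-v)))
                    (realises-≈⁺ R (canonical-realises v) (inj₁ refl))
  -- The span is the greatest fall, so the opposite word is the one with peak r; it induces the same
  -- partition.
  ... | inj₂ eq = List.lose (∈-ws {negate v} (trans (sym eq) (trans (sym (span-peaks v)) span-v)))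
                    (realises-≈⁺ R (canonical-realises (negate v)) (inj₂ refl))

  has-partition : ∀ {v} → v List.∈ ws → Any (λ ρ → ρ ≈ induced (canonical v)) (filter P? (𝒞 (suc m)))
  has-partition {v} v∈
    with _ , peak≡ ← ∈-filter⁻ (λ v → peak 0 v ≟ r) {xs = words signs m} v∈
    with ρ , ρ∈ , ρ≈ ← List.find (𝒞-complete (canonical v) (realises⇒endomorphism (canonical-realises v)))
    -- The listed representative may come from another endomorphism, so its length is found from its
    -- own word w, which equals v up to sign and has the same span.
    with f , refl , s , w , R ← ∈-𝒞⁻ ρ∈
    = List.lose (∈-filter⁺ P? ρ∈ (trans (length-induced R) (cong suc (span-w (realises-≈⁻ R (canonical-realises v) ρ≈))))) ρ≈
    where
    span-w : ∀ {w} → w ≡ v ⊎ w ≡ negate v → span w ≡ r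
    span-w (inj₁ refl) = span≡ {v} peak≡
    span-w (inj₂ refl) = trans (span-negate v) (span≡ {v} peak≡)

-- Polynomials over ℚ

-- Fractions in ℚ are normalised and do not add by computation; the identity is checked on
-- unnormalised fractions with denominator 1.
fromℕ-+ : ∀ m n → fromℕ (m + n) ≡ fromℕ m ℚ.+ fromℕ n
fromℕ-+ m n = ℚ.toℚᵘ-injective (begin-equality
  ℚ.toℚᵘ (fromℕ (m + n))        ≃⟨ ℚ.toℚᵘ-fromℚᵘ (ℚᵘ.mkℚᵘ (+ (m + n)) 0) ⟩
  ℚᵘ.mkℚᵘ (+ (m + n)) 0         ≃⟨ ℚᵘ.*≡* (cong (ℤ._* (+ 1)) (cong₂ ℤ._+_ (sym (ℤ.*-identityʳ (+ m))) (sym (ℤ.*-identityʳ (+ n))))) ⟩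
  ℚᵘ.mkℚᵘ (+ m) 0 ℚᵘ.+ ℚᵘ.mkℚᵘ (+ n) 0
    ≃⟨ ℚᵘ.+-cong (ℚ.toℚᵘ-fromℚᵘ (ℚᵘ.mkℚᵘ (+ m) 0)) (ℚ.toℚᵘ-fromℚᵘ (ℚᵘ.mkℚᵘ (+ n) 0)) ⟨
  ℚ.toℚᵘ (fromℕ m) ℚᵘ.+ ℚ.toℚᵘ (fromℕ n) ≃⟨ ℚ.toℚᵘ-homo-+ (fromℕ m) (fromℕ n) ⟨
  ℚ.toℚᵘ (fromℕ m ℚ.+ fromℕ n) ∎)
  where open ℚᵘ.≤-Reasoning

fromℕ-* : ∀ m n → fromℕ (m * n) ≡ fromℕ m ℚ.* fromℕ n
fromℕ-* zero    n = sym (ℚ.*-zeroˡ (fromℕ n))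
fromℕ-* (suc m) n = begin
  fromℕ (n + m * n)           ≡⟨ fromℕ-+ n (m * n) ⟩
  fromℕ n ℚ.+ fromℕ (m * n)     ≡⟨ cong₂ ℚ._+_ (sym (ℚ.*-identityˡ (fromℕ n))) (fromℕ-* m n) ⟩
  1ℚ ℚ.* fromℕ n ℚ.+ fromℕ m ℚ.* fromℕ n ≡⟨ ℚ.*-distribʳ-+ (fromℕ n) 1ℚ (fromℕ m) ⟨
  (1ℚ ℚ.+ fromℕ m) ℚ.* fromℕ n    ≡⟨ cong (ℚ._* fromℕ n) (fromℕ-+ 1 m) ⟨
  fromℕ (suc m) ℚ.* fromℕ n ∎
  where open ≡-Reasoning

-- The polynomial carry + (α x + β) · cs.
linearTimes : ∀ {m} → ℚ → ℚ → ℚ → Vec ℚ m → Vec ℚ (suc m)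
linearTimes α β carry []       = carry ∷ []
linearTimes α β carry (c ∷ cs) = carry ℚ.+ β ℚ.* c ∷ linearTimes α β (α ℚ.* c) cs

evaluate-linearTimes : ∀ {m} α β carry (cs : Vec ℚ m) x →
  evaluate (linearTimes α β carry cs) x ≡ carry ℚ.+ (α ℚ.* x ℚ.+ β) ℚ.* evaluate cs x
evaluate-linearTimes α β carry []       x =
  solve 4 (λ α β k x → k :+ x :* con 0ℚ := k :+ (α :* x :+ β) :* con 0ℚ) refl α β carry x
  where open +-*-Solver
evaluate-linearTimes α β carry (c ∷ cs) x =
  trans (cong (λ t → carry ℚ.+ β ℚ.* c ℚ.+ x ℚ.* t) (evaluate-linearTimes α β (α ℚ.* c) cs x))
    (solve 6 (λ α β k x c e → k :+ β :* c :+ x :* (α :* c :+ (α :* x :+ β) :* e)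
                           := k :+ (α :* x :+ β) :* (c :+ x :* e)) refl α β carry x c (evaluate cs x))
  where open +-*-Solver

last-linearTimes : ∀ {m} α β carry (cs : Vec ℚ (suc m)) →
  Vec.last (linearTimes α β carry cs) ≡ α ℚ.* Vec.last cs
last-linearTimes α β carry (c ∷ [])      = refl
last-linearTimes α β carry (c ∷ d ∷ cs)  = last-linearTimes α β (α ℚ.* c) (d ∷ cs)

-- (k + 1) (m C (k + 1)) = (m - k) (m C k), moved so that no subtraction occurs.
nCk-absorb : ∀ m k → suc k * (m C suc k) + k * (m C k) ≡ m * (m C k)
nCk-absorb zero    zero    = refl
nCk-absorb zero    (suc k) = cong₂ _+_ (*-zeroʳ k) (*-zeroʳ k)
nCk-absorb (suc m) zero    = trans (cong (λ t → t + 0 + 0) (nC1≡n (suc m)))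
  (trans (rearrange m) (cong (suc m *_) (sym (nC0≡1 (suc m)))))
  where
  rearrange : ∀ m → suc m + 0 + 0 ≡ suc m * 1
  rearrange = solve-∀
nCk-absorb (suc m) (suc k) = begin
  suc (suc k) * (suc m C suc (suc k)) + suc k * (suc m C suc k)
    ≡⟨ cong₂ (λ s t → suc (suc k) * s + suc k * t)
         (sym (nCk+nC[k+1]≡[n+1]C[k+1] m (suc k))) (sym (nCk+nC[k+1]≡[n+1]C[k+1] m k)) ⟩
  suc (suc k) * (b + c) + suc k * (a + b)
    ≡⟨ split k a b c ⟩
  (suc (suc k) * c + suc k * b) + (suc k * b + k * a) + (a + b)
    ≡⟨ cong₂ (λ s t → s + t + (a + b)) (nCk-absorb m (suc k)) (nCk-absorb m k) ⟩
  m * b + m * a + (a + b)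
    ≡⟨ join m a b ⟩
  suc m * (a + b)
    ≡⟨ cong (suc m *_) (nCk+nC[k+1]≡[n+1]C[k+1] m k) ⟩
  suc m * (suc m C suc k) ∎
  where
  open ≡-Reasoning
  a = m C k
  b = m C suc k
  c = m C suc (suc k)
  split : ∀ k a b c → suc (suc k) * (b + c) + suc k * (a + b)
    ≡ (suc (suc k) * c + suc k * b) + (suc k * b + k * a) + (a + b)
  split = solve-∀
  join : ∀ m a b → m * b + m * a + (a + b) ≡ suc m * (a + b)
  join = solve-∀

1/suc : ℕ → ℚ
1/suc j = (+ 1) ℚ./ suc j

1/suc-inverse : ∀ j → 1/suc j ℚ.* fromℕ (suc j) ≡ 1ℚ
1/suc-inverse j = ℚ.toℚᵘ-injective (begin-equality
  ℚ.toℚᵘ (1/suc j ℚ.* fromℕ (suc j))        ≃⟨ ℚ.toℚᵘ-homo-* (1/suc j) (fromℕ (suc j)) ⟩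
  ℚ.toℚᵘ (1/suc j) ℚᵘ.* ℚ.toℚᵘ (fromℕ (suc j))
    ≃⟨ ℚᵘ.*-cong (ℚ.toℚᵘ-fromℚᵘ (ℚᵘ.mkℚᵘ (+ 1) j)) (ℚ.toℚᵘ-fromℚᵘ (ℚᵘ.mkℚᵘ (+ suc j) 0)) ⟩
  ℚᵘ.mkℚᵘ (+ 1) j ℚᵘ.* ℚᵘ.mkℚᵘ (+ suc j) 0  ≃⟨ ℚᵘ.*-inverseˡ (ℚᵘ.mkℚᵘ (+ suc j) 0) ⟩
  ℚᵘ.1ℚᵘ ∎)
  where open ℚᵘ.≤-Reasoning

-- The polynomial c (x - e choose j), from (y choose j + 1) = (y choose j) (y - j) / (j + 1).
choosePoly : ℚ → ℕ → (j : ℕ) → Vec ℚ (suc j)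
choosePoly c e zero    = c ∷ []
choosePoly c e (suc j) =
  linearTimes (1/suc j) (1/suc j ℚ.* ℚ.- fromℕ (e + j)) 0ℚ (choosePoly c e j)

-- With the argument written as e + m, the new linear factor is (m - j) / (j + 1), and `nCk-absorb`
-- turns it into the passage from m C j to m C (j + 1).
evaluate-choosePoly : ∀ c e j m →
  evaluate (choosePoly c e j) (fromℕ (e + m)) ≡ c ℚ.* fromℕ (m C j)
evaluate-choosePoly c e zero m = trans
  (solve 2 (λ c x → c :+ x :* con 0ℚ := c :* con 1ℚ) refl c (fromℕ (e + m)))
  (cong (λ t → c ℚ.* fromℕ t) (sym (nC0≡1 m)))
  where open +-*-Solver
evaluate-choosePoly c e (suc j) m = begin
  evaluate (choosePoly c e (suc j)) (fromℕ (e + m))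
    ≡⟨ evaluate-linearTimes α (α ℚ.* ℚ.- fromℕ (e + j)) 0ℚ (choosePoly c e j) (fromℕ (e + m)) ⟩
  0ℚ ℚ.+ (α ℚ.* fromℕ (e + m) ℚ.+ α ℚ.* ℚ.- fromℕ (e + j)) ℚ.* evaluate (choosePoly c e j) (fromℕ (e + m))
    ≡⟨ cong₂ (λ s t → 0ℚ ℚ.+ (α ℚ.* s ℚ.+ α ℚ.* ℚ.- t) ℚ.* evaluate (choosePoly c e j) (fromℕ (e + m)))
             (fromℕ-+ e m) (fromℕ-+ e j) ⟩
  0ℚ ℚ.+ (α ℚ.* (fromℕ e ℚ.+ fromℕ m) ℚ.+ α ℚ.* ℚ.- (fromℕ e ℚ.+ fromℕ j)) ℚ.* evaluate (choosePoly c e j) (fromℕ (e + m))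
    ≡⟨ cong (λ t → 0ℚ ℚ.+ (α ℚ.* (fromℕ e ℚ.+ fromℕ m) ℚ.+ α ℚ.* ℚ.- (fromℕ e ℚ.+ fromℕ j)) ℚ.* t)
            (evaluate-choosePoly c e j m) ⟩
  0ℚ ℚ.+ (α ℚ.* (fromℕ e ℚ.+ fromℕ m) ℚ.+ α ℚ.* ℚ.- (fromℕ e ℚ.+ fromℕ j)) ℚ.* (c ℚ.* fromℕ (m C j))
    ≡⟨ solve 6 (λ α e m j c b → con 0ℚ :+ (α :* (e :+ m) :+ α :* :- (e :+ j)) :* (c :* b)
                  := α :* c :* (m :* b :- j :* b))
         refl α (fromℕ e) (fromℕ m) (fromℕ j) c (fromℕ (m C j)) ⟩
  α ℚ.* c ℚ.* (fromℕ m ℚ.* fromℕ (m C j) ℚ.- fromℕ j ℚ.* fromℕ (m C j))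
    ≡⟨ cong (λ t → α ℚ.* c ℚ.* (t ℚ.- fromℕ j ℚ.* fromℕ (m C j))) absorbed ⟩
  α ℚ.* c ℚ.* (fromℕ (suc j) ℚ.* fromℕ (m C suc j) ℚ.+ fromℕ j ℚ.* fromℕ (m C j) ℚ.- fromℕ j ℚ.* fromℕ (m C j))
    ≡⟨ solve 5 (λ α c s b′ d → α :* c :* (s :* b′ :+ d :- d) := α :* s :* (c :* b′)) refl
         α c (fromℕ (suc j)) (fromℕ (m C suc j)) (fromℕ j ℚ.* fromℕ (m C j)) ⟩
  α ℚ.* fromℕ (suc j) ℚ.* (c ℚ.* fromℕ (m C suc j))
    ≡⟨ cong (ℚ._* (c ℚ.* fromℕ (m C suc j))) (1/suc-inverse j) ⟩
  1ℚ ℚ.* (c ℚ.* fromℕ (m C suc j))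
    ≡⟨ ℚ.*-identityˡ _ ⟩
  c ℚ.* fromℕ (m C suc j) ∎
  where
  open ≡-Reasoning
  open +-*-Solver
  α = 1/suc j
  absorbed : fromℕ m ℚ.* fromℕ (m C j) ≡ fromℕ (suc j) ℚ.* fromℕ (m C suc j) ℚ.+ fromℕ j ℚ.* fromℕ (m C j)
  absorbed = begin
    fromℕ m ℚ.* fromℕ (m C j) ≡⟨ fromℕ-* m (m C j) ⟨
    fromℕ (m * (m C j))     ≡⟨ cong fromℕ (nCk-absorb m j) ⟨
    fromℕ (suc j * (m C suc j) + j * (m C j)) ≡⟨ fromℕ-+ (suc j * (m C suc j)) (j * (m C j)) ⟩
    fromℕ (suc j * (m C suc j)) ℚ.+ fromℕ (j * (m C j))
      ≡⟨ cong₂ ℚ._+_ (fromℕ-* (suc j) (m C suc j)) (fromℕ-* j (m C j)) ⟩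
    fromℕ (suc j) ℚ.* fromℕ (m C suc j) ℚ.+ fromℕ j ℚ.* fromℕ (m C j) ∎

-- The leading coefficient is c / j!. Positivity passes through the products and gives that it is
-- nonzero.
last-choosePoly-pos : ∀ c .{{_ : ℚ.Positive c}} e j → ℚ.Positive (Vec.last (choosePoly c e j))
last-choosePoly-pos c {{c>0}} e zero    = ℚ.positive (ℚ.positive⁻¹ c)
last-choosePoly-pos c e (suc j) =
  subst ℚ.Positive (sym (last-linearTimes (1/suc j) _ 0ℚ (choosePoly c e j)))
    (ℚ.pos*pos⇒pos (1/suc j) {{ℚ.normalize-pos 1 (suc j)}}
                   (Vec.last (choosePoly c e j)) {{last-choosePoly-pos c e j}})

-- Covers both parities of k: n C j is the case c = 1, e = 0, and 2 ((n - 1) C j) is the case c = 2,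
-- e = 1.
choose-polynomial : ∀ n₀ c .{{_ : ℚ.Positive c}} e j g →
  (∀ n → n₀ ≤ n → e ≤ n × fromℕ (g n) ≡ c ℚ.* fromℕ ((n ∸ e) C j)) →
  PolynomialFrom n₀ j g
choose-polynomial n₀ c e j g formula =
  choosePoly c e j ,
  (λ last≡0 → ℚ.<⇒≢ (ℚ.positive⁻¹ _ {{last-choosePoly-pos c e j}}) (sym last≡0)) ,
  λ n n₀≤n → let e≤n , eq = formula n n₀≤n in
    trans eq (trans (sym (evaluate-choosePoly c e j (n ∸ e)))
                    (cong (λ t → evaluate (choosePoly c e j) (fromℕ t)) (m+[n∸m]≡n e≤n)))

-- The formula for `l`, its two parities and its degree

l-formula-shifted : ∀ d r → d < r → l (suc d) (suc (r + d)) ≡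
  binom (r + d) (+ ⌈ suc d /2⌉ -ℤ 1ℤ) + binom (r + d) (+ ⌊ suc d /2⌋ -ℤ 1ℤ)
l-formula-shifted d r d<r = begin
  -- Here d = k - 1 and r = n - k, so d < r says n ≥ 2 k.
  length (filter (λ ρ → length ρ ≟ (r + d ∸ d) + 1) (𝒞 (suc (r + d))))
    ≡⟨ cong (λ t → length (filter (λ ρ → length ρ ≟ t) (𝒞 (suc (r + d)))))
         (trans (+-comm _ 1) (cong suc (m+n∸n≡m r d))) ⟩
  length (filter (λ ρ → length ρ ≟ suc r) (𝒞 (suc (r + d))))
    ≡⟨ l-count (r + d) r (+-monoʳ-< r (≤-trans d<r (m≤m+n r 0))) ⟩
  count {r + d} (λ v → peak 0 v ≟ r)
    ≡⟨ count-peak-formula d r d<r ⟩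
  -- The first binomial of the statement reduces to this one, since ⌈(d + 1)/2⌉ - 1 computes to
  -- ⌊d/2⌋.
  (r + d) C ⌊ d /2⌋ + binom (r + d) (+ ⌊ suc d /2⌋ -ℤ 1ℤ) ∎
  where open ≡-Reasoning

l-formula : ∀ k n → 1 ≤ k → 2 * k ≤ n →
  l k n ≡ binom (n ∸ 1) (+ ⌈ k /2⌉ -ℤ 1ℤ) + binom (n ∸ 1) (+ ⌊ k /2⌋ -ℤ 1ℤ)
l-formula k@(suc d) n _ 2k≤n
  with r , refl ← m≤n⇒∃[o]m+o≡n (≤-trans (m≤m+n k (k + 0)) 2k≤n)
  rewrite +-comm d r
  = l-formula-shifted d r (+-cancelˡ-≤ k k r
      (≤-trans (≤-reflexive (cong (_+_ k) (sym (+-identityʳ k)))) (≤-trans 2k≤n (≤-reflexive (cong suc (+-comm r d))))))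

l-even : ∀ j n → 1 ≤ j → 2 * (j + j) ≤ n → l (j + j) n ≡ 2 * binom (n ∸ 1) (+ j -ℤ 1ℤ)
l-even j n 1≤j 4j≤n = begin
  l (j + j) n ≡⟨ l-formula (j + j) n (≤-trans 1≤j (m≤m+n j j)) 4j≤n ⟩
  b ⌈ j + j /2⌉ + b ⌊ j + j /2⌋ ≡⟨ cong₂ (λ s t → b s + b t) (n≡⌈n+n/2⌉ j) (n≡⌊n+n/2⌋ j) ⟨
  b j + b j ≡⟨ cong (_+_ (b j)) (+-identityʳ (b j)) ⟨
  2 * b j ∎
  where
  open ≡-Reasoning
  b : ℕ → ℕ
  b i = binom (n ∸ 1) (+ i -ℤ 1ℤ)

-- For k = 2 j + 1 the lower indices are j and j - 1, and Pascal's rule merges the two terms. At j =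
-- 0 the second is 0 by convention.
l-odd : ∀ j n → 2 * suc (j + j) ≤ n → l (suc (j + j)) n ≡ n C j
l-odd j n@(suc m) 4j+2≤n = begin
  l (suc (j + j)) n                          ≡⟨ l-formula (suc (j + j)) n (s≤s z≤n) 4j+2≤n ⟩
  m C ⌊ j + j /2⌋ + b ⌈ j + j /2⌉            ≡⟨ cong₂ (λ s t → m C s + b t) (n≡⌊n+n/2⌋ j) (n≡⌈n+n/2⌉ j) ⟨
  m C j + b j                                ≡⟨ pascal j ⟩
  suc m C j ∎
  where
  open ≡-Reasoning
  b : ℕ → ℕ
  b i = binom m (+ i -ℤ 1ℤ)
  pascal : ∀ j → m C j + b j ≡ suc m C j
  pascal zero    = trans (+-identityʳ _) (trans (nC0≡1 m) (sym (nC0≡1 (suc m))))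
  pascal (suc j) = trans (+-comm (m C suc j) (m C j)) (nCk+nC[k+1]≡[n+1]C[k+1] m j)

evenOrOdd : ∀ d → ∃ λ j → d ≡ j + j ⊎ d ≡ suc (j + j)
evenOrOdd zero    = 0 , inj₁ refl
evenOrOdd (suc d) with evenOrOdd d
... | j , inj₁ refl = j , inj₂ refl
... | j , inj₂ refl = suc j , inj₁ (cong suc (sym (+-suc j j)))

degree-odd : ∀ j → degree (suc (j + j)) ≡ j
degree-odd zero    = refl
degree-odd (suc j) = trans (cong ⌈_/2⌉ (+-suc j j)) (cong suc (sym (n≡⌊n+n/2⌋ j)))

l-polynomial : ∀ k → 1 ≤ k → PolynomialFrom (2 * k) (degree k) (l k)
l-polynomial (suc d) _ with evenOrOdd d
-- Since d = k - 1, an even d belongs to odd k = 2 j + 1, and an odd d to k = 2 j + 2.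
... | j , inj₁ refl = subst (λ e → PolynomialFrom (2 * suc (j + j)) e (l (suc (j + j)))) (sym (degree-odd j))
  (choose-polynomial _ 1ℚ 0 j (l (suc (j + j))) λ n le →
    z≤n , trans (cong fromℕ (l-odd j n le)) (sym (ℚ.*-identityˡ (fromℕ (n C j)))))
... | j , inj₂ refl = subst (λ e → PolynomialFrom (2 * suc (suc (j + j))) e (l (suc (suc (j + j))))) (n≡⌈n+n/2⌉ j)
  (choose-polynomial _ (fromℕ 2) 1 j (l (suc (suc (j + j)))) λ n le →
    ≤-trans (s≤s z≤n) le ,
    trans (cong fromℕ (even n le)) (fromℕ-* 2 ((n ∸ 1) C j)))
  where
  even : ∀ n → 2 * suc (suc (j + j)) ≤ n → l (suc (suc (j + j))) n ≡ 2 * ((n ∸ 1) C j)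
  even n le = subst (λ k → 2 * k ≤ n → l k n ≡ 2 * ((n ∸ 1) C j)) (cong suc (+-suc j j))
    (l-even (suc j) n (s≤s z≤n)) le

theorem3 : (∀ k n → 1 ≤ k → 2 * k ≤ n →
    l k n ≡ binom (n ∸ 1) (+ ⌈ k /2⌉ -ℤ 1ℤ) + binom (n ∸ 1) (+ ⌊ k /2⌋ -ℤ 1ℤ))
    × (∀ k n → 1 ≤ k → 4 * k ≤ n →
    l (2 * k) n ≡ 2 * binom (n ∸ 1) (+ k -ℤ 1ℤ))
    × (∀ k n → 1 ≤ k → 4 * k + 2 ≤ n →
    l (2 * k + 1) n ≡ n C k)
    × (∀ k → 1 ≤ k → PolynomialFrom (2 * k) (degree k) (l k))
theorem3 = l-formula
  , (λ k n 1≤k 4k≤n → subst (λ t → l t n ≡ 2 * binom (n ∸ 1) (+ k -ℤ 1ℤ)) (k+k≡2k k)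
       (l-even k n 1≤k (≤-trans (≤-reflexive (4k k)) 4k≤n)))
  , (λ k n _ 4k+2≤n → subst (λ t → l t n ≡ n C k) (1+k+k≡2k+1 k)
       (l-odd k n (≤-trans (≤-reflexive (4k+2 k)) 4k+2≤n)))
  , l-polynomial
  where
  k+k≡2k : ∀ k → k + k ≡ 2 * k
  k+k≡2k = solve-∀
  4k : ∀ k → 2 * (k + k) ≡ 4 * k
  4k = solve-∀
  1+k+k≡2k+1 : ∀ k → suc (k + k) ≡ 2 * k + 1
  1+k+k≡2k+1 = solve-∀
  4k+2 : ∀ k → 2 * suc (k + k) ≡ 4 * k + 2
  4k+2 = solve-∀
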